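{- Let $q$ be a prime power and let $t, n$ be positive integers. Suppose that $S$ is a subset of the points of the projective space $\mathrm{PG}(n,q)$ such that no $t+1$ (distinct) points of $S$ lie on a common line of $\mathrm{PG}(n,q)$. Then $$|S|\,q^{n+1} \leq ex\bigl(q^{n+1}, |S|q^n, \{C_4, \theta_{3,t}\}\bigr).$$
   Context: $\mathrm{PG}(n,q)$ denotes the projective space of (projective) dimension $n$ over the finite field $\mathbb{F}_q$, i.e. the projective space associated with the vector space $\mathbb{F}_q^{n+1}$. For a family $\mathcal{F}$ of graphs, $ex(a,b,\mathcal{F})$ is the maximum number of edges in a bipartite graph whose part sizes are $a$ and $b$ and which contains no graph in $\mathcal{F}$ as a (not necessarily induced) subgraph. $C_4$ is the cycle of length 4. $\theta_{3,t}$ is the theta graph consisting of two vertices joined by $t$ internally vertex-disjoint paths, each with exactly 3 edges. -}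

module Defs where

open import Algebra.Apartness.Bundles using (HeytingField)
import Algebra.Apartness.Properties.HeytingCommutativeRing as HCRProperties
open import Data.Empty using (⊥)
open import Data.Fin using (Fin; zero; suc; finToFun; funToFin) renaming (_≟_ to _≟ᶠ_)
open import Data.Fin.Properties using (all?; any?; inj⇒≟; finToFun-funToFin; +↔⊎)
open import Data.Fin.Subset using (Subset; inside; outside; _∈_; ∣_∣)
open import Data.Fin.Subset.Properties using (_∈?_)
open import Data.Bool using (true; false)
open import Data.List using (List; []; _∷_; map; filter; cartesianProductWith)
open import Data.List.Extrema.Nat using (max; v≤max⁺; argmax-sel)
open import Data.List.Membership.Propositional using (lose) renaming (_∈_ to _∈ₗ_)
open import Data.List.Membership.Propositional.Properties
  using (∈-cartesianProductWith⁺; ∈-filter⁺; ∈-filter⁻; ∈-map⁺; ∈-map⁻)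
open import Data.List.Relation.Unary.All as All using (All)
open import Data.List.Relation.Unary.Any using (here; there)
open import Data.Nat using (ℕ; zero; suc; _+_; _^_; _≤_; z≤n)
open import Data.Nat.Primality using (Prime)
open import Data.Nat.Properties using (≤-refl; ≤-antisym)
open import Data.Product using (Σ; ∃; ∃-syntax; _×_; _,_; proj₁; proj₂)
open import Data.Sum using (_⊎_; inj₁; inj₂)
open import Data.Vec as Vec using (Vec; []; _∷_; lookup)
import Data.Vec.Functional as Vector
import Data.Vec.Functional.Relation.Binary.Equality.Setoid as VectorEquality
open import Function using (_∘_; Injective; _↔_; Inverse; mk↔ₛ′)
open import Function.Properties.Inverse using (↔-sym; Inverse⇒Injection)
open import Level using (Level; 0ℓ; _⊔_) renaming (suc to lsuc)
open import Relation.Binary using (Rel; Setoid; IsEquivalence; _Respects_; Symmetric)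
import Relation.Binary.Construct.On as On
open import Relation.Binary.Construct.Closure.Symmetric using (SymClosure; fwd; bwd; symmetric)
open import Relation.Binary.Definitions using (Decidable; DecidableEquality)
open import Relation.Binary.PropositionalEquality as ≡ using (_≡_; _≗_; refl; cong; subst; subst₂)
open import Relation.Nullary using (¬_; Dec; yes; no)
open import Relation.Nullary.Decidable using (map′; _×-dec_; _→-dec_; ¬?)
open import Relation.Unary using (Pred)

private
  variable
    a b : ℕ
    ℓ ℓ′ : Level

IsPrimePower : ℕ → Set
IsPrimePower q = ∃[ p ] ∃[ k ] Prime p × 1 ≤ k × q ≡ p ^ k

HasCardinality : Setoid ℓ ℓ′ → ℕ → Set (ℓ ⊔ ℓ′)
HasCardinality A m = Inverse (≡.setoid (Fin m)) A

------------------------------------------------------------------------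
-- Projective space

-- Classically a HeytingField is exactly a field, with x # y meaning x ≉ y.

module PG {c ℓ₁ ℓ₂} (K : HeytingField c ℓ₁ ℓ₂) (n : ℕ) where

  open HeytingField K hiding (_+_)
  open HeytingField K using () renaming (_+_ to _+ᴷ_)
  open HCRProperties heytingCommutativeRing using (1#0; x#0y#0→xy#0; invertibleˡ⇒#; x-0≈x)
  open VectorEquality setoid public using (_≋_)

  V : Set c
  V = Vector.Vector Carrier (suc n)

  0ᵥ : V
  0ᵥ = Vector.replicate (suc n) 0#

  infixl 6 _+ᵥ_
  infixr 7 _·_

  _+ᵥ_ : V → V → V
  _+ᵥ_ = Vector.zipWith _+ᴷ_

  _·_ : Carrier → V → V
  k · v = Vector.map (k *_) v

  -- A point is a one-dimensional subspace, represented by a vector spanning it;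
  -- two representatives are the same point when they are proportional.

  record Point : Set (c ⊔ ℓ₁) where
    constructor ⟨_,_⟩
    field
      rep     : V
      nonzero : ¬ (rep ≋ 0ᵥ)

  open Point public

  infix 4 _≈ₚ_

  _≈ₚ_ : Rel Point (c ⊔ ℓ₁ ⊔ ℓ₂)
  P ≈ₚ Q = ∃[ k ] k # 0# × rep P ≋ k · rep Q

  ≈ₚ-isEquivalence : IsEquivalence _≈ₚ_
  ≈ₚ-isEquivalence = record
    { refl  = λ {P} → 1# , 1#0 , λ i → sym (*-identityˡ (rep P i))
    ; sym   = λ {P} {Q} → ≈ₚ-sym {P} {Q}
    ; trans = λ { (k , k#0 , e) (l , l#0 , f) →
        k * l , x#0y#0→xy#0 k#0 l#0 ,
        λ i → trans (e i) (trans (*-congˡ (f i)) (sym (*-assoc k l _))) }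
    }
    where
    ≈ₚ-sym : Symmetric _≈ₚ_
    ≈ₚ-sym (k , k#0 , e) with #⇒invertible k#0
    ... | k⁻¹ , k⁻¹k≈1 , kk⁻¹≈1 =
      k⁻¹ ,
      invertibleˡ⇒# (k , trans (*-congˡ (x-0≈x k⁻¹)) (trans (*-congʳ (sym (x-0≈x k))) kk⁻¹≈1)) ,
      λ i → sym (trans (*-congˡ (e i))
                (trans (sym (*-assoc k⁻¹ k _))
                (trans (*-congʳ (trans (*-congˡ (sym (x-0≈x k))) k⁻¹k≈1))
                       (*-identityˡ _))))

  -- A line is a two-dimensional subspace, represented by a basis.

  record Line : Set (c ⊔ ℓ₁) where
    field
      u w         : V
      independent : ∀ x y → x · u +ᵥ y · w ≋ 0ᵥ → x ≈ 0# × y ≈ 0#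

  infix 4 _on_

  _on_ : Point → Line → Set (c ⊔ ℓ₁)
  P on L = ∃[ x ] ∃[ y ] rep P ≋ x · u +ᵥ y · w
    where open Line L

  record PointSet ℓ : Set (c ⊔ ℓ₁ ⊔ ℓ₂ ⊔ lsuc ℓ) where
    field
      Member   : Pred Point ℓ
      respects : Member Respects _≈ₚ_

    points : Setoid (c ⊔ ℓ₁ ⊔ ℓ) (c ⊔ ℓ₁ ⊔ ℓ₂)
    points = record
      { Carrier       = Σ Point Member
      ; _≈_           = λ P Q → proj₁ P ≈ₚ proj₁ Q
      ; isEquivalence = On.isEquivalence proj₁ ≈ₚ-isEquivalence
      }

  HasCollinear : PointSet ℓ → ℕ → Set (c ⊔ ℓ₁ ⊔ ℓ₂ ⊔ ℓ)
  HasCollinear S m =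
    ∃[ L ] Σ (Fin m → Point) λ P →
      (∀ i j → P i ≈ₚ P j → i ≡ j) × (∀ i → Member (P i)) × (∀ i → P i on L)
    where open PointSet S

------------------------------------------------------------------------
-- Finite simple graphs

record Graph : Set₁ where
  infix 4 _~_ _~?_
  field
    Vertex   : Set
    order    : ℕ
    vertices : Fin order ↔ Vertex
    _~_      : Rel Vertex 0ℓ
    _~?_     : Decidable _~_
    ~-sym    : Symmetric _~_
    ~-irrefl : ∀ v → ¬ (v ~ v)

private
  symClosure? : ∀ {A : Set} {R : Rel A 0ℓ} → Decidable R → Decidable (SymClosure R)
  symClosure? R? x y with R? x y | R? y x
  ... | yes r | _     = yes (fwd r)
  ... | no _  | yes r = yes (bwd r)
  ... | no ¬r | no ¬s = no λ { (fwd r) → ¬r r ; (bwd s) → ¬s s }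

  symClosure-irrefl : ∀ {A : Set} {R : Rel A 0ℓ} → (∀ x → ¬ R x x) → ∀ x → ¬ SymClosure R x x
  symClosure-irrefl irr x (fwd r) = irr x r
  symClosure-irrefl irr x (bwd r) = irr x r

data C₄Edge : Rel (Fin 4) 0ℓ where
  e₀₁ : C₄Edge zero (suc zero)
  e₁₂ : C₄Edge (suc zero) (suc (suc zero))
  e₂₃ : C₄Edge (suc (suc zero)) (suc (suc (suc zero)))
  e₃₀ : C₄Edge (suc (suc (suc zero))) zero

private
  c₄Edge? : Decidable C₄Edge
  c₄Edge? zero zero = no λ ()
  c₄Edge? zero (suc zero) = yes e₀₁
  c₄Edge? zero (suc (suc _)) = no λ ()
  c₄Edge? (suc zero) zero = no λ ()
  c₄Edge? (suc zero) (suc zero) = no λ ()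
  c₄Edge? (suc zero) (suc (suc zero)) = yes e₁₂
  c₄Edge? (suc zero) (suc (suc (suc zero))) = no λ ()
  c₄Edge? (suc (suc zero)) zero = no λ ()
  c₄Edge? (suc (suc zero)) (suc zero) = no λ ()
  c₄Edge? (suc (suc zero)) (suc (suc zero)) = no λ ()
  c₄Edge? (suc (suc zero)) (suc (suc (suc zero))) = yes e₂₃
  c₄Edge? (suc (suc (suc zero))) zero = yes e₃₀
  c₄Edge? (suc (suc (suc zero))) (suc _) = no λ ()

C₄ : Graph
C₄ = record
  { Vertex   = Fin 4
  ; order    = 4
  ; vertices = mk↔ₛ′ (λ i → i) (λ i → i) (λ _ → refl) (λ _ → refl)
  ; _~_      = SymClosure C₄Edge
  ; _~?_     = symClosure? c₄Edge?
  ; ~-sym    = symmetric C₄Edge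
  ; ~-irrefl = symClosure-irrefl λ _ ()
  }

-- θ₃ t has end vertices source and target, joined for each i : Fin t by the
-- path  source — near i — far i — target.

data θVertex (t : ℕ) : Set where
  source target : θVertex t
  near far      : Fin t → θVertex t

data θEdge {t} : Rel (θVertex t) 0ℓ where
  first  : ∀ i → θEdge source (near i)
  middle : ∀ i → θEdge (near i) (far i)
  last   : ∀ i → θEdge (far i) target

private
  θEdge? : ∀ {t} → Decidable (θEdge {t})
  θEdge? source source = no λ ()
  θEdge? source target = no λ ()
  θEdge? source (near i) = yes (first i)
  θEdge? source (far _) = no λ ()
  θEdge? target _ = no λ ()
  θEdge? (near _) source = no λ ()
  θEdge? (near _) target = no λ ()
  θEdge? (near _) (near _) = no λ ()
  θEdge? (near i) (far j) = map′ (λ { refl → middle i }) (λ { (middle _) → refl }) (i ≟ᶠ j)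
  θEdge? (far _) source = no λ ()
  θEdge? (far i) target = yes (last i)
  θEdge? (far _) (near _) = no λ ()
  θEdge? (far _) (far _) = no λ ()

  θVertices : ∀ {t} → Fin (2 + (t + t)) ↔ θVertex t
  θVertices {t} = mk↔ₛ′ to from to∘from from∘to
    where
    module S = Inverse (+↔⊎ {t} {t})

    inner : Fin t ⊎ Fin t → θVertex t
    inner (inj₁ i) = near i
    inner (inj₂ i) = far i

    to : Fin (2 + (t + t)) → θVertex t
    to zero          = source
    to (suc zero)    = target
    to (suc (suc k)) = inner (S.to k)

    from : θVertex t → Fin (2 + (t + t))
    from source   = zero
    from target   = suc zero
    from (near i) = suc (suc (S.from (inj₁ i)))
    from (far i)  = suc (suc (S.from (inj₂ i)))

    to∘from : ∀ v → to (from v) ≡ v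
    to∘from source   = refl
    to∘from target   = refl
    to∘from (near i) = cong inner (S.strictlyInverseˡ (inj₁ i))
    to∘from (far i)  = cong inner (S.strictlyInverseˡ (inj₂ i))

    from-inner : ∀ x → from (inner x) ≡ suc (suc (S.from x))
    from-inner (inj₁ _) = refl
    from-inner (inj₂ _) = refl

    from∘to : ∀ k → from (to k) ≡ k
    from∘to zero          = refl
    from∘to (suc zero)    = refl
    from∘to (suc (suc k)) =
      ≡.trans (from-inner (S.to k)) (cong (λ i → suc (suc i)) (S.strictlyInverseʳ k))

θ₃ : ℕ → Graph
θ₃ t = record
  { Vertex   = θVertex t
  ; order    = 2 + (t + t)
  ; vertices = θVertices
  ; _~_      = SymClosure θEdge
  ; _~?_     = symClosure? θEdge?
  ; ~-sym    = symmetric θEdge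
  ; ~-irrefl = symClosure-irrefl λ _ ()
  }

------------------------------------------------------------------------
-- Subgraph containment (not necessarily induced)

module _ (G H : Graph) where
  private
    module G = Graph G
    module H = Graph H

  IsEmbedding : (H.Vertex → G.Vertex) → Set
  IsEmbedding f = Injective _≡_ _≡_ f × (∀ {x y} → x H.~ y → f x G.~ f y)

  Contains : Set
  Contains = ∃ IsEmbedding

private
  module Finite {A : Set} {m} (e : Fin m ↔ A) where
    open Inverse e public

    ∀? : {P : Pred A ℓ} → (∀ x → Dec (P x)) → Dec (∀ x → P x)
    ∀? {P = P} P? = map′ (λ h x → subst P (strictlyInverseˡ x) (h (from x))) (λ h i → h (to i))
                         (all? (P? ∘ to))

    infix 4 _≟_
    _≟_ : DecidableEquality A
    _≟_ = inj⇒≟ (Inverse⇒Injection (↔-sym e))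

contains? : ∀ G H → Dec (Contains G H)
contains? G H = map′ (λ (k , emb) → fun k , emb) complete (any? (isEmbedding? ∘ fun))
  where
  module G  = Graph G
  module H  = Graph H
  module FG = Finite G.vertices
  module FH = Finite H.vertices

  fun : Fin (G.order ^ H.order) → H.Vertex → G.Vertex
  fun k x = FG.to (finToFun k (FH.from x))

  isEmbedding? : ∀ f → Dec (IsEmbedding G H f)
  isEmbedding? f =
    map′ (λ h {x} {y} → h x y) (λ h x y → h)
         (FH.∀? λ x → FH.∀? λ y → (f x FG.≟ f y) →-dec (x FH.≟ y))
    ×-dec
    map′ (λ h {x} {y} → h x y) (λ h x y → h)
         (FH.∀? λ x → FH.∀? λ y → (x H.~? y) →-dec (f x G.~? f y))

  respects : ∀ {f g} → f ≗ g → IsEmbedding G H f → IsEmbedding G H g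
  respects f≗g (inj , hom) =
    (λ {x} {y} gx≡gy → inj (≡.trans (f≗g x) (≡.trans gx≡gy (≡.sym (f≗g y))))) ,
    (λ {x} {y} x~y → subst₂ G._~_ (f≗g x) (f≗g y) (hom x~y))

  complete : Contains G H → ∃ (IsEmbedding G H ∘ fun)
  complete (f , emb) = funToFin code , respects f≗fun emb
    where
    code : Fin H.order → Fin G.order
    code i = FG.from (f (FH.to i))

    f≗fun : f ≗ fun (funToFin code)
    f≗fun x = ≡.sym (≡.trans (cong FG.to (finToFun-funToFin code (FH.from x)))
                    (≡.trans (FG.strictlyInverseˡ _) (cong f (FH.strictlyInverseˡ x))))

Free : List Graph → Graph → Set₁
Free 𝓕 G = All (λ H → ¬ Contains G H) 𝓕

free? : ∀ 𝓕 G → Dec (Free 𝓕 G)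
free? 𝓕 G = All.all? (¬? ∘ contains? G) 𝓕

------------------------------------------------------------------------
-- Bipartite graphs and extremal numbers

-- Row i is the set of neighbours, in the second part, of vertex i of the first.

BipartiteGraph : ℕ → ℕ → Set
BipartiteGraph a b = Vec (Subset b) a

edgeCount : BipartiteGraph a b → ℕ
edgeCount B = Vec.sum (Vec.map ∣_∣ B)

module _ (B : BipartiteGraph a b) where

  BAdj : Rel (Fin a ⊎ Fin b) 0ℓ
  BAdj (inj₁ i) (inj₂ j) = j ∈ lookup B i
  BAdj (inj₂ j) (inj₁ i) = j ∈ lookup B i
  BAdj (inj₁ _) (inj₁ _) = ⊥
  BAdj (inj₂ _) (inj₂ _) = ⊥

  private
    bAdj? : Decidable BAdj
    bAdj? (inj₁ i) (inj₂ j) = j ∈? lookup B i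
    bAdj? (inj₂ j) (inj₁ i) = j ∈? lookup B i
    bAdj? (inj₁ _) (inj₁ _) = no λ ()
    bAdj? (inj₂ _) (inj₂ _) = no λ ()

    bAdj-sym : Symmetric BAdj
    bAdj-sym {inj₁ _} {inj₂ _} e = e
    bAdj-sym {inj₂ _} {inj₁ _} e = e

    bAdj-irrefl : ∀ v → ¬ BAdj v v
    bAdj-irrefl (inj₁ _) ()
    bAdj-irrefl (inj₂ _) ()

  toGraph : Graph
  toGraph = record
    { Vertex   = Fin a ⊎ Fin b
    ; order    = a + b
    ; vertices = +↔⊎
    ; _~_      = BAdj
    ; _~?_     = bAdj?
    ; ~-sym    = λ {x} {y} → bAdj-sym {x} {y}
    ; ~-irrefl = bAdj-irrefl
    }

allVecs : {A : Set ℓ} → List A → ∀ m → List (Vec A m)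
allVecs xs zero    = [] ∷ []
allVecs xs (suc m) = cartesianProductWith _∷_ xs (allVecs xs m)

allVecs-complete : {A : Set ℓ} {xs : List A} → (∀ x → x ∈ₗ xs) →
                   ∀ {m} (v : Vec A m) → v ∈ₗ allVecs xs m
allVecs-complete h []      = here refl
allVecs-complete h (x ∷ v) = ∈-cartesianProductWith⁺ _∷_ (h x) (allVecs-complete h v)

bipartiteGraphs : ∀ a b → List (BipartiteGraph a b)
bipartiteGraphs a b = allVecs (allVecs (outside ∷ inside ∷ []) b) a

bipartiteGraphs-complete : (B : BipartiteGraph a b) → B ∈ₗ bipartiteGraphs a b
bipartiteGraphs-complete =
  allVecs-complete (allVecs-complete λ { false → here refl ; true → there (here refl) })

-- The value is 0 if no bipartite graph with these part sizes is 𝓕-free.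

ex : ℕ → ℕ → List Graph → ℕ
ex a b 𝓕 = max 0 (map edgeCount (filter (free? 𝓕 ∘ toGraph) (bipartiteGraphs a b)))

ex-upper : ∀ 𝓕 (B : BipartiteGraph a b) → Free 𝓕 (toGraph B) → edgeCount B ≤ ex a b 𝓕
ex-upper 𝓕 B free =
  v≤max⁺ 0 _ (inj₂ (lose (∈-map⁺ edgeCount B∈) ≤-refl))
  where
  B∈ = ∈-filter⁺ (free? 𝓕 ∘ toGraph) (bipartiteGraphs-complete B) free

ex-attained : ∀ 𝓕 (B : BipartiteGraph a b) → Free 𝓕 (toGraph B) →
              Σ (BipartiteGraph a b) λ M → Free 𝓕 (toGraph M) × edgeCount M ≡ ex a b 𝓕
ex-attained {a} {b} 𝓕 B free
  with argmax-sel (λ k → k) 0 (map edgeCount (filter (free? 𝓕 ∘ toGraph) (bipartiteGraphs a b)))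
... | inj₁ ex≡0 =
  B , free , ≤-antisym (ex-upper 𝓕 B free) (subst (_≤ edgeCount B) (≡.sym ex≡0) z≤n)
... | inj₂ ex∈ with ∈-map⁻ edgeCount ex∈
...   | M , M∈ , ex≡ = M , proj₂ (∈-filter⁻ (free? 𝓕 ∘ toGraph) {xs = bipartiteGraphs a b} M∈) , ≡.sym ex≡

{-# OPTIONS --safe #-}

-- The vertices of the extremal graph are the vectors of K^(n+1) on one side and,
-- on the other, the affine lines whose direction belongs to S; each vector lies
-- on exactly one line in every direction. Two distinct vectors lie on at most
-- one line, which excludes C₄. In a θ₃ t with ends a vector p and a line ℓ, the
-- t paths give lines mᵢ through p that meet ℓ in vectors xᵢ ≠ p. The directions
-- of ℓ and of the mᵢ are pairwise distinct, and all lie in the span of the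
-- directions of ℓ and m₀, so that S would contain t + 1 collinear points.

module Submission where

open import Defs
open import Algebra.Apartness.Bundles using (HeytingCommutativeRing; HeytingField)
import Algebra.Apartness.Properties.HeytingCommutativeRing as HeytingCommutativeRingProperties
open import Algebra.Bundles using (CommutativeRing)
import Algebra.Properties.Group as GroupProperties
import Algebra.Properties.Ring as RingProperties
open import Data.Empty using (⊥)
open import Data.Fin using (Fin; zero; suc; finToFun; funToFin; punchIn; punchOut;
                            quotient; remainder; combine)
  renaming (_≟_ to _≟ᶠ_)
open import Data.Fin.Properties
  using (any?; ¬∀⟶∃¬; finToFun-funToFin; funToFin-finToFin; punchIn-punchOut;
         remQuot-combine; combine-remQuot; combine-injectiveˡ; suc-injective)
open import Data.Fin.Subset using (Subset; _∈_; _-_; ∣_∣)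
open import Data.Fin.Subset.Properties using (x∈p⇒∣p-x∣<∣p∣; x∈p∧x≢y⇒x∈p-y)
open import Data.List using ([]; _∷_)
open import Data.List.Relation.Unary.All using ([]; _∷_)
open import Data.Nat using (ℕ; suc; _+_; _*_; _^_; _≤_; z≤n; s≤s)
open import Data.Nat.Properties using (≤-trans; +-mono-≤; +-comm; *-comm; module ≤-Reasoning)
open import Data.Product using (∃₂; ∃-syntax; _×_; _,_; proj₁; proj₂)
open import Data.Sum using (_⊎_; inj₁; inj₂; [_,_]′)
import Data.Vec as Vec
open import Data.Vec.Properties using ([]=⇒lookup; lookup⇒[]=; lookup∘tabulate)
open import Function using (_∘_; Injective; Inverse)
open import Relation.Binary using (IsEquivalence)
open import Relation.Binary.Definitions using (Decidable)
open import Relation.Binary.Construct.Closure.Symmetric using (fwd)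
open import Relation.Binary.PropositionalEquality as ≡ using (_≡_; _≢_; _≗_; refl; cong; subst)
import Relation.Binary.Reasoning.Setoid as ≈-Reasoning
open import Relation.Nullary using (¬_; Dec; yes; no; does; contradiction)
open import Relation.Nullary.Decidable using (map′; decidable-stable; dec-true)

private
  variable
    a b m n t : ℕ

-- Functions between finite sets coded as numbers

funToFin-injective : {f g : Fin m → Fin n} → funToFin f ≡ funToFin g → f ≗ g
funToFin-injective {f = f} {g} eq i =
  ≡.trans (≡.sym (finToFun-funToFin f i))
  (≡.trans (cong (λ k → finToFun k i) eq) (finToFun-funToFin g i))

funToFin-cong : {f g : Fin m → Fin n} → f ≗ g → funToFin f ≡ funToFin g
funToFin-cong {m = ℕ.zero} f≗g = refl
funToFin-cong {m = suc m}  f≗g = ≡.cong₂ combine (f≗g zero) (funToFin-cong (f≗g ∘ suc))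

finToFun-injective : {i j : Fin (n ^ m)} → finToFun {n} {m} i ≗ finToFun j → i ≡ j
finToFun-injective {n} {m} {i} {j} eq =
  ≡.trans (≡.sym (funToFin-finToFin {m} {n} i))
  (≡.trans (funToFin-cong eq) (funToFin-finToFin {m} {n} j))

-- Counting edges

-- Induction on `m`: deleting `f zero` makes `p` strictly smaller, and by injectivity the other
-- values of `f` survive the deletion.
injective⇒≤∣p∣ : (p : Subset b) (f : Fin m → Fin b) → Injective _≡_ _≡_ f →
                 (∀ i → f i ∈ p) → m ≤ ∣ p ∣
injective⇒≤∣p∣ {m = ℕ.zero} p f inj f∈p = z≤n
injective⇒≤∣p∣ {m = suc m}  p f inj f∈p = ≤-trans
  (s≤s (injective⇒≤∣p∣ (p - f zero) (f ∘ suc) (suc-injective ∘ inj)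
    λ i → x∈p∧x≢y⇒x∈p-y (f∈p (suc i)) λ eq → contradiction (inj eq) λ ()))
  (x∈p⇒∣p-x∣<∣p∣ (f∈p zero))

edgeCount-tabulate-≥ : (f : Fin a → Subset b) → (∀ i → m ≤ ∣ f i ∣) →
                       a * m ≤ edgeCount (Vec.tabulate f)
edgeCount-tabulate-≥ {a = ℕ.zero} f h = z≤n
edgeCount-tabulate-≥ {a = suc a}  f h =
  +-mono-≤ (h zero) (edgeCount-tabulate-≥ (f ∘ suc) (h ∘ suc))

module _ {ℓ} {R : Fin a → Fin b → Set ℓ} (R? : ∀ i j → Dec (R i j)) where

  row : Fin a → Subset b
  row i = Vec.tabulate (does ∘ R? i)

  relationGraph : BipartiteGraph a b
  relationGraph = Vec.tabulate row

  ∈-row⁺ : ∀ {i j} → R i j → j ∈ row i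
  ∈-row⁺ {i} {j} r = lookup⇒[]= j (row i) (≡.trans (lookup∘tabulate _ j) (dec-true (R? i j) r))

  ∈-relationGraph⁻ : ∀ {i j} → j ∈ Vec.lookup relationGraph i → R i j
  ∈-relationGraph⁻ {i} {j} j∈
    with R? i j | ≡.trans (≡.sym (lookup∘tabulate (does ∘ R? i) j))
                          ([]=⇒lookup (subst (j ∈_) (lookup∘tabulate row i) j∈))
  -- When `R? i j` is a `no`, the second equation reads `false ≡ true`.
  ... | yes r | _ = r

-- Forbidden subgraphs of bipartite graphs

module _ (B : BipartiteGraph a b) where

  private
    open Graph (toGraph B) using (_~_; ~-sym)

    infix 4 _∋_
    _∋_ : Fin b → Fin a → Set
    l ∋ x = l ∈ Vec.lookup B x

  -- A 4-cycle alternates between the parts, so each of its diagonals joins two vertices of one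
  -- part. The hypothesis identifies the ends of one diagonal, against injectivity of the embedding.
  C₄-free : (∀ x y l m → l ∋ x → l ∋ y → m ∋ x → m ∋ y → x ≡ y ⊎ l ≡ m) →
            ¬ Contains (toGraph B) C₄
  C₄-free unique (f , inj , hom) =
    [ (λ eq → contradiction (inj eq) λ ()) , (λ eq → contradiction (inj eq) λ ()) ]′
      (diagonal (f zero) (f (suc zero)) (f (suc (suc zero))) (f (suc (suc (suc zero))))
        (hom (fwd e₀₁)) (hom (fwd e₁₂)) (hom (fwd e₂₃)) (hom (fwd e₃₀)))
    where
    diagonal : ∀ u v w z → u ~ v → v ~ w → w ~ z → z ~ u → u ≡ w ⊎ v ≡ z
    diagonal (inj₁ x) (inj₂ l) (inj₁ y) (inj₂ m) lx ly my mx with unique x y l m lx ly mx my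
    ... | inj₁ x≡y = inj₁ (cong inj₁ x≡y)
    ... | inj₂ l≡m = inj₂ (cong inj₂ l≡m)
    diagonal (inj₂ l) (inj₁ x) (inj₂ m) (inj₁ y) lx mx my ly with unique x y l m lx ly mx my
    ... | inj₁ x≡y = inj₂ (cong inj₁ x≡y)
    ... | inj₂ l≡m = inj₁ (cong inj₂ l≡m)

  -- The paths have odd length, so the end vertices lie in different parts. At least one path is
  -- required, to refute end vertices in the same part; hence `suc t`.
  θ₃-free : (∀ x l (y : Fin (suc t) → Fin a) (m : Fin (suc t) → Fin b) →
               (∀ i → m i ∋ x) → (∀ i → m i ∋ y i) → (∀ i → l ∋ y i) →
               Injective _≡_ _≡_ m → (∀ i → m i ≢ l) → (∀ i → y i ≢ x) → ⊥) →
            ¬ Contains (toGraph B) (θ₃ (suc t))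
  θ₃-free {t} none (f , inj , hom) =
    paths (f source) (f target) (f ∘ near) (f ∘ far)
      (λ i → hom (fwd (first i))) (λ i → hom (fwd (middle i))) (λ i → hom (fwd (last i)))
      (λ eq → near-injective (inj eq)) (λ eq → far-injective (inj eq))
      (λ i eq → contradiction (inj eq) λ ()) (λ i eq → contradiction (inj eq) λ ())
    where
    near-injective : Injective _≡_ _≡_ (near {suc t})
    near-injective refl = refl

    far-injective : Injective _≡_ _≡_ (far {suc t})
    far-injective refl = refl

    path : ∀ {x l} u v → inj₁ x ~ u → u ~ v → v ~ inj₂ l →
           ∃₂ λ m y → u ≡ inj₂ m × v ≡ inj₁ y × m ∋ x × m ∋ y × l ∋ y
    path (inj₂ m) (inj₁ y) mx my ly = m , y , refl , refl , mx , my , ly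

    paths : ∀ u v (p r : Fin (suc t) → Fin a ⊎ Fin b) →
            (∀ i → u ~ p i) → (∀ i → p i ~ r i) → (∀ i → r i ~ v) →
            Injective _≡_ _≡_ p → Injective _≡_ _≡_ r →
            (∀ i → p i ≢ v) → (∀ i → r i ≢ u) → ⊥
    paths (inj₁ x) (inj₂ l) p r up pr rv p-inj _ p≢v r≢u =
      none x l (λ i → proj₁ (proj₂ (k i))) (λ i → proj₁ (k i))
        (λ i → let _ , _ , _ , _ , mx , _ = k i in mx)
        (λ i → let _ , _ , _ , _ , _ , my , _ = k i in my)
        (λ i → let _ , _ , _ , _ , _ , _ , ly = k i in ly)
        (λ {i} {j} eq → p-inj (≡.trans (p≡ i) (≡.trans (cong inj₂ eq) (≡.sym (p≡ j)))))
        (λ i eq → p≢v i (≡.trans (p≡ i) (cong inj₂ eq)))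
        (λ i eq → r≢u i (≡.trans (r≡ i) (cong inj₁ eq)))
      where
      k = λ i → path (p i) (r i) (up i) (pr i) (rv i)
      p≡ = λ i → proj₁ (proj₂ (proj₂ (k i)))
      r≡ = λ i → proj₁ (proj₂ (proj₂ (proj₂ (k i))))
    -- Reading every path backwards exchanges near and far vertices and reduces this case to the
    -- previous one.
    paths (inj₂ l) (inj₁ x) p r up pr rv p-inj r-inj p≢v r≢u =
      paths (inj₁ x) (inj₂ l) r p
        (λ i → ~-sym {r i} (rv i)) (λ i → ~-sym {p i} (pr i)) (λ i → ~-sym {inj₂ l} (up i))
        r-inj p-inj r≢u p≢v
    -- Path number `zero` already gives a contradiction: three edges cannot return to the part they
    -- started from.
    paths (inj₁ x) (inj₁ y) p r up pr rv _ _ _ _ = odd (p zero) (r zero) (up zero) (pr zero) (rv zero)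
      where
      odd : ∀ u v → inj₁ x ~ u → u ~ v → v ~ inj₁ y → ⊥
      odd (inj₂ _) (inj₁ _) _ _ ()
      odd (inj₂ _) (inj₂ _) _ () _
    paths (inj₂ l) (inj₂ m) p r up pr rv _ _ _ _ = odd (p zero) (r zero) (up zero) (pr zero) (rv zero)
      where
      odd : ∀ u v → inj₂ l ~ u → u ~ v → v ~ inj₂ m → ⊥
      odd (inj₁ _) (inj₂ _) _ _ ()
      odd (inj₁ _) (inj₁ _) _ () _

-- Projective space over a finite field

module _ {c ℓ₁ ℓ₂ q} (𝔽 : HeytingField c ℓ₁ ℓ₂)
         (finite : HasCardinality (HeytingField.setoid 𝔽) q) where

  open HeytingField 𝔽 using (heytingCommutativeRing; tight; #⇒invertible; _#_)
  open HeytingCommutativeRingProperties heytingCommutativeRing using (invertibleˡ⇒#; x-0≈x)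
  open CommutativeRing (HeytingCommutativeRing.commutativeRing heytingCommutativeRing)
    hiding (refl; zero) renaming (_+_ to _⊕_; _-_ to _⊖_; _*_ to _⊛_; +-comm to ⊕-comm; *-comm to ⊛-comm)
  open RingProperties ring using (-‿distribˡ-*; [y-z]x≈yx-zx)
  open GroupProperties +-group using (inverseˡ-unique; inverseʳ-unique; ∙-cancelˡ; //-rightDividesˡ)
  open Inverse finite using (to; from; to-cong; from-cong; strictlyInverseˡ; strictlyInverseʳ)

  from-injective : ∀ {x y} → from x ≡ from y → x ≈ y
  from-injective {x} {y} eq =
    trans (sym (strictlyInverseˡ x)) (trans (to-cong eq) (strictlyInverseˡ y))

  to-injective : ∀ {i j} → to i ≈ to j → i ≡ j
  to-injective {i} {j} eq =
    ≡.trans (≡.sym (strictlyInverseʳ i)) (≡.trans (from-cong eq) (strictlyInverseʳ j))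

  infix 4 _≈?_
  _≈?_ : Decidable _≈_
  x ≈? y = map′ from-injective from-cong (from x ≟ᶠ from y)

  #0⇒inverse : ∀ {x} → x # 0# → ∃[ y ] y ⊛ x ≈ 1#
  #0⇒inverse {x} x#0 with #⇒invertible x#0
  ... | y , yx≈1 , _ = y , trans (*-congˡ (sym (x-0≈x x))) yx≈1

  -- Tightness only gives ¬ ¬ x # 0#; searching the finite field for an inverse
  -- removes the double negation.
  ≉0⇒#0 : ∀ {x} → ¬ x ≈ 0# → x # 0#
  ≉0⇒#0 {x} x≉0 with any? (λ i → to i ⊛ x ≈? 1#)
  ... | yes (i , e) = invertibleˡ⇒# (to i , trans (*-congˡ (x-0≈x x)) e)
  ... | no none = contradiction (proj₁ (tight x 0#) λ x#0 →
          let y , e = #0⇒inverse x#0 in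
          none (from y , trans (*-congʳ (strictlyInverseˡ y)) e)) x≉0

  module _ {n : ℕ} where

    open PG 𝔽 n

    -- Equality in a finite field is decidable, so a nonzero coordinate can be found by search.
    pivot : (P : Point) → ∃[ k ] rep P k # 0#
    pivot P with ¬∀⟶∃¬ (suc n) _ (λ i → rep P i ≈? 0#) (nonzero P)
    ... | k , Pk≉0 = k , ≉0⇒#0 Pk≉0

    ·-cancelˡ : ∀ {x y} {v w : V} → y ⊛ x ≈ 1# → x · v ≋ w → v ≋ y · w
    ·-cancelˡ {x} {y} {v} {w} yx≈1 xv≋w i = begin
      v i            ≈⟨ *-identityˡ (v i) ⟨
      1# ⊛ v i       ≈⟨ *-congʳ yx≈1 ⟨
      y ⊛ x ⊛ v i    ≈⟨ *-assoc y x (v i) ⟩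
      y ⊛ (x ⊛ v i)  ≈⟨ *-congˡ (xv≋w i) ⟩
      y ⊛ w i        ∎
      where open ≈-Reasoning setoid

    -- Only `x` has to be assumed nonzero: if the resulting factor `z ⊛ y` vanished, so would
    -- `rep P`.
    proportional⇒≈ₚ : ∀ {x y P Q} → ¬ x ≈ 0# → x · rep P ≋ y · rep Q → P ≈ₚ Q
    proportional⇒≈ₚ {x} {y} {P} {Q} x≉0 xP≋yQ with #0⇒inverse (≉0⇒#0 x≉0)
    ... | z , zx≈1 = z ⊛ y , ≉0⇒#0 zy≉0 , P≋
      where
      P≋ : rep P ≋ (z ⊛ y) · rep Q
      P≋ i = trans (·-cancelˡ {v = rep P} {y · rep Q} zx≈1 xP≋yQ i) (sym (*-assoc z y _))
      zy≉0 : ¬ z ⊛ y ≈ 0#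
      zy≉0 e = nonzero P λ i → trans (P≋ i) (trans (*-congʳ e) (zeroˡ _))

    -- A linear relation with a nonzero coefficient would make the two points proportional.
    -- Decidable equality turns this contradiction into the vanishing of both coefficients.
    lineThrough : ∀ P Q → ¬ P ≈ₚ Q → Line
    lineThrough P Q P≉Q = record
      { u = rep P
      ; w = rep Q
      ; independent = λ x y e →
          decidable-stable (x ≈? 0#) (λ x≉0 → P≉Q (proportional⇒≈ₚ {P = P} {Q} x≉0 λ i →
            trans (inverseˡ-unique _ _ (e i)) (-‿distribˡ-* y _))) ,
          decidable-stable (y ≈? 0#) (λ y≉0 → P≉Q (IsEquivalence.sym ≈ₚ-isEquivalence {Q} {P}
            (proportional⇒≈ₚ {P = Q} {P} y≉0 λ i →
            trans (inverseʳ-unique _ _ (e i)) (-‿distribˡ-* x _))))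
      }

    -- Affine lines in a fixed direction

    module _ (P : Point) where

      private
        k   = proj₁ (pivot P)
        k⁻¹ = proj₁ (#0⇒inverse (proj₂ (pivot P)))

        -- The multiple of `rep P` whose subtraction from `v` makes coordinate `k` vanish.
        slope : V → Carrier
        slope v = v k ⊛ k⁻¹

      -- Encodes the affine line through v in the direction P by the point where
      -- it meets the hyperplane on which the pivot coordinate vanishes.
      intercept : V → Fin (q ^ n)
      intercept v = funToFin λ i →
        from (v (punchIn k i) ⊖ slope v ⊛ rep P (punchIn k i))

      private
        slope-pivot : ∀ v → v k ⊖ slope v ⊛ rep P k ≈ 0#
        slope-pivot v = begin
          v k ⊖ v k ⊛ k⁻¹ ⊛ rep P k    ≈⟨ +-congˡ (-‿cong (*-assoc (v k) k⁻¹ (rep P k))) ⟩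
          v k ⊖ v k ⊛ (k⁻¹ ⊛ rep P k)  ≈⟨ +-congˡ (-‿cong (*-congˡ (proj₂ (#0⇒inverse (proj₂ (pivot P)))))) ⟩
          v k ⊖ v k ⊛ 1#               ≈⟨ +-congˡ (-‿cong (*-identityʳ (v k))) ⟩
          v k ⊖ v k                    ≈⟨ -‿inverseʳ (v k) ⟩
          0#                           ∎
          where open ≈-Reasoning setoid

        -- The code records every coordinate except `k`, and at `k` both sides are zero by
        -- `slope-pivot`.
        intercept-coordinates : ∀ {v w} → intercept v ≡ intercept w →
          ∀ i → v i ⊖ slope v ⊛ rep P i ≈ w i ⊖ slope w ⊛ rep P i
        intercept-coordinates {v} {w} eq i with k ≟ᶠ i
        ... | yes refl = trans (slope-pivot v) (sym (slope-pivot w))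
        ... | no k≢i   = subst (λ j → v j ⊖ slope v ⊛ rep P j ≈ w j ⊖ slope w ⊛ rep P j)
                (punchIn-punchOut k≢i) (from-injective (funToFin-injective eq (punchOut k≢i)))

      -- Both vectors project along `P` to the same point of the hyperplane, so they differ by the
      -- difference of their slopes times `rep P`.
      intercept-≡ : ∀ {v w} → intercept v ≡ intercept w → ∃[ x ] v ≋ w +ᵥ x · rep P
      intercept-≡ {v} {w} eq = slope v ⊖ slope w , λ i → let p = rep P i in begin
        v i                                      ≈⟨ //-rightDividesˡ (slope v ⊛ p) (v i) ⟨
        v i ⊖ slope v ⊛ p ⊕ slope v ⊛ p          ≈⟨ +-congʳ (intercept-coordinates eq i) ⟩
        w i ⊖ slope w ⊛ p ⊕ slope v ⊛ p          ≈⟨ +-assoc _ _ _ ⟩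
        w i ⊕ (- (slope w ⊛ p) ⊕ slope v ⊛ p)    ≈⟨ +-congˡ (⊕-comm _ _) ⟩
        w i ⊕ (slope v ⊛ p ⊖ slope w ⊛ p)        ≈⟨ +-congˡ ([y-z]x≈yx-zx p (slope v) (slope w)) ⟨
        w i ⊕ (slope v ⊖ slope w) ⊛ p            ∎
        where open ≈-Reasoning setoid

-- The vector–line incidence graph

    module _ {ℓ s} (S : PointSet ℓ) (size : HasCardinality (PointSet.points S) s) where

      private
        module S = PointSet S
        module I = Inverse size

      vector : Fin (q ^ suc n) → V
      vector x i = to (finToFun x i)

      vector-injective : ∀ {x y} → vector x ≋ vector y → x ≡ y
      vector-injective eq = finToFun-injective (to-injective ∘ eq)

      -- A line is coded as a pair packed into one number: the quotient indexes its direction in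
      -- `S`, the remainder is its intercept.
      directionIndex : Fin (s * q ^ n) → Fin s
      directionIndex = quotient (q ^ n)

      direction : Fin (s * q ^ n) → Point
      direction = proj₁ ∘ I.to ∘ directionIndex

      Incident : Fin (q ^ suc n) → Fin (s * q ^ n) → Set
      Incident x l = intercept (direction l) (vector x) ≡ remainder {s} (q ^ n) l

      incident? : ∀ x l → Dec (Incident x l)
      incident? x l = _ ≟ᶠ _

      incidenceGraph : BipartiteGraph (q ^ suc n) (s * q ^ n)
      incidenceGraph = relationGraph incident?

      lineAt : Fin (q ^ suc n) → Fin s → Fin (s * q ^ n)
      lineAt x d = combine d (intercept (proj₁ (I.to d)) (vector x))

      lineAt-incident : ∀ x d → Incident x (lineAt x d)
      lineAt-incident x d = ≡.trans
        (cong (λ d → intercept (proj₁ (I.to d)) (vector x)) (cong proj₁ split))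
        (≡.sym (cong proj₂ split))
        where split = remQuot-combine {s} {q ^ n} d (intercept (proj₁ (I.to d)) (vector x))

      -- The direction can be read off from `lineAt x d`, so `lineAt x` injects the `s` directions
      -- into the row of `x`.
      edgeCount-incidenceGraph : q ^ suc n * s ≤ edgeCount incidenceGraph
      edgeCount-incidenceGraph = edgeCount-tabulate-≥ (row incident?) λ x →
        injective⇒≤∣p∣ _ (lineAt x) (combine-injectiveˡ _ _ _ _)
          λ d → ∈-row⁺ incident? (lineAt-incident x d)

      difference : ∀ x y l → Incident x l → Incident y l →
                   ∃[ z ] vector x ≋ vector y +ᵥ z · rep (direction l)
      difference x y l xl yl = intercept-≡ (direction l) (≡.trans xl (≡.sym yl))

      difference-nonzero : ∀ x y {z} (P : Point) → x ≢ y →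
                           vector x ≋ vector y +ᵥ z · rep P → ¬ z ≈ 0#
      difference-nonzero x y P x≢y e z≈0 = x≢y (vector-injective λ i →
        trans (e i) (trans (+-congˡ (trans (*-congʳ z≈0) (zeroˡ _))) (+-identityʳ _)))

      -- The enumeration of `S` is injective up to `≈ₚ`, so the direction indices are equal. The
      -- intercepts then agree too, both being that of `x` in this one direction.
      parallel⇒≡ : ∀ x l m → Incident x l → Incident x m → direction l ≈ₚ direction m → l ≡ m
      parallel⇒≡ x l m xl xm l∥m =
        ≡.trans (≡.sym (combine-remQuot {s} (q ^ n) l))
        (≡.trans (≡.cong₂ combine d≡ r≡) (combine-remQuot {s} (q ^ n) m))
        where
        d≡ : directionIndex l ≡ directionIndex m
        d≡ = ≡.trans (≡.sym (I.strictlyInverseʳ _)) (≡.trans (I.from-cong l∥m) (I.strictlyInverseʳ _))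
        r≡ : remainder {s} (q ^ n) l ≡ remainder {s} (q ^ n) m
        r≡ = ≡.trans (≡.sym xl) (≡.trans (cong (λ d → intercept (proj₁ (I.to d)) (vector x)) d≡) xm)

      -- If `x ≢ y`, their difference is a nonzero multiple of the direction of `l` and also a
      -- multiple of that of `m`. The lines are therefore parallel, and they share `x`.
      lines-meet-once : ∀ x y l m → Incident x l → Incident y l → Incident x m → Incident y m →
                        x ≡ y ⊎ l ≡ m
      lines-meet-once x y l m xl yl xm ym with x ≟ᶠ y
      ... | yes x≡y = inj₁ x≡y
      ... | no x≢y = inj₂ (parallel⇒≡ x l m xl xm
              (proportional⇒≈ₚ {z} {z′} {direction l} {direction m}
                (difference-nonzero x y (direction l) x≢y e)
                λ i → ∙-cancelˡ (vector y i) _ _ (trans (sym (e i)) (e′ i))))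
        where
        z  = proj₁ (difference x y l xl yl)
        z′ = proj₁ (difference x y m xm ym)
        e  = proj₂ (difference x y l xl yl)
        e′ = proj₂ (difference x y m xm ym)

      -- The `suc t` directions of the `m i` together with that of `l` make up the `suc (suc t)`
      -- points.
      transversals⇒HasCollinear :
        ∀ x l (y : Fin (suc t) → Fin (q ^ suc n)) (m : Fin (suc t) → Fin (s * q ^ n)) →
        (∀ i → Incident x (m i)) → (∀ i → Incident (y i) (m i)) → (∀ i → Incident (y i) l) →
        Injective _≡_ _≡_ m → (∀ i → m i ≢ l) → (∀ i → y i ≢ x) →
        HasCollinear S (suc (suc t))
      transversals⇒HasCollinear {t} x l y m xm ym yl m-inj m≢l y≢x =
        L , P , P-inj , P∈S , P-on-L
        where
        m∦l : ∀ i → ¬ direction l ≈ₚ direction (m i)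
        m∦l i l∥m = m≢l i (≡.sym (parallel⇒≡ (y i) l (m i) (yl i) (ym i) l∥m))

        L : Line
        L = lineThrough (direction l) (direction (m zero)) (m∦l zero)

        index : Fin (suc (suc t)) → Fin (s * q ^ n)
        index zero    = l
        index (suc i) = m i

        P : Fin (suc (suc t)) → Point
        P = direction ∘ index

        -- Parallel lines with a common vector coincide: `l` and `m i` share `y i`, while `m i` and
        -- `m j` share `x`.
        P-inj : ∀ i j → P i ≈ₚ P j → i ≡ j
        P-inj zero    zero    _   = refl
        P-inj zero    (suc j) l∥m = contradiction l∥m (m∦l j)
        P-inj (suc i) zero    m∥l = contradiction (parallel⇒≡ (y i) (m i) l (ym i) (yl i) m∥l) (m≢l i)
        P-inj (suc i) (suc j) m∥m = cong suc (m-inj (parallel⇒≡ x (m i) (m j) (xm i) (xm j) m∥m))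

        P∈S : ∀ i → S.Member (P i)
        P∈S i = proj₂ (I.to (directionIndex (index i)))

        P-on-L : ∀ i → P i on L
        P-on-L zero = 1# , 0# , λ i →
          sym (trans (+-cong (*-identityˡ _) (zeroˡ _)) (+-identityʳ _))
        -- Split `y i - x` as `(y i - y zero) + (y zero - x)`. The three differences lie along
        -- `m i`, `l` and `m zero`, which gives `α · w ≋ ε · u +ᵥ α₀ · w₀`. Here `α` is invertible
        -- because `y i ≢ x`, and dividing by it yields the coefficients.
        P-on-L (suc i) = α⁻¹ ⊛ ε , α⁻¹ ⊛ α₀ , λ j → begin
          w j                                  ≈⟨ ·-cancelˡ {α} {α⁻¹} {w} {ε · u +ᵥ α₀ · w₀} α⁻¹α≈1 combination j ⟩
          α⁻¹ ⊛ (ε ⊛ u j ⊕ α₀ ⊛ w₀ j)          ≈⟨ distribˡ α⁻¹ (ε ⊛ u j) (α₀ ⊛ w₀ j) ⟩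
          α⁻¹ ⊛ (ε ⊛ u j) ⊕ α⁻¹ ⊛ (α₀ ⊛ w₀ j)  ≈⟨ +-cong (*-assoc α⁻¹ ε (u j)) (*-assoc α⁻¹ α₀ (w₀ j)) ⟨
          α⁻¹ ⊛ ε ⊛ u j ⊕ α⁻¹ ⊛ α₀ ⊛ w₀ j      ∎
          where
          open ≈-Reasoning setoid
          w  = rep (direction (m i))
          u  = rep (direction l)
          w₀ = rep (direction (m zero))

          yᵢ-x  = difference (y i) x (m i) (ym i) (xm i)
          yᵢ-y₀ = difference (y i) (y zero) l (yl i) (yl zero)
          y₀-x  = difference (y zero) x (m zero) (ym zero) (xm zero)

          α  = proj₁ yᵢ-x
          ε  = proj₁ yᵢ-y₀
          α₀ = proj₁ y₀-x

          α-inverse = #0⇒inverse (≉0⇒#0 (difference-nonzero (y i) x (direction (m i)) (y≢x i) (proj₂ yᵢ-x)))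
          α⁻¹    = proj₁ α-inverse
          α⁻¹α≈1 = proj₂ α-inverse

          combination : α · w ≋ ε · u +ᵥ α₀ · w₀
          combination j = ∙-cancelˡ (vector x j) _ _ (begin
            vector x j ⊕ α ⊛ w j                    ≈⟨ proj₂ yᵢ-x j ⟨
            vector (y i) j                          ≈⟨ proj₂ yᵢ-y₀ j ⟩
            vector (y zero) j ⊕ ε ⊛ u j             ≈⟨ +-congʳ (proj₂ y₀-x j) ⟩
            vector x j ⊕ α₀ ⊛ w₀ j ⊕ ε ⊛ u j        ≈⟨ +-assoc _ _ _ ⟩
            vector x j ⊕ (α₀ ⊛ w₀ j ⊕ ε ⊛ u j)      ≈⟨ +-congˡ (⊕-comm _ _) ⟩
            vector x j ⊕ (ε ⊛ u j ⊕ α₀ ⊛ w₀ j)      ∎)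

      incidenceGraph-free : ¬ HasCollinear S (suc (suc t)) →
                            Free (C₄ ∷ θ₃ (suc t) ∷ []) (toGraph incidenceGraph)
      incidenceGraph-free ¬collinear =
        C₄-free incidenceGraph
          (λ x y l m xl yl xm ym → lines-meet-once x y l m (⁻ xl) (⁻ yl) (⁻ xm) (⁻ ym)) ∷
        θ₃-free incidenceGraph
          (λ x l y m xm ym yl m-inj m≢l y≢x → ¬collinear
            (transversals⇒HasCollinear x l y m (⁻ ∘ xm) (⁻ ∘ ym) (⁻ ∘ yl) m-inj m≢l y≢x)) ∷
        []
        where
        ⁻ : ∀ {x l} → l ∈ Vec.lookup incidenceGraph x → Incident x l
        ⁻ = ∈-relationGraph⁻ incident?

theorem1p1 : ∀ {c ℓ₁ ℓ₂ ℓ} (q t n : ℕ) → IsPrimePower q → 1 ≤ t → 1 ≤ n →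
    (𝔽 : HeytingField c ℓ₁ ℓ₂) → HasCardinality (HeytingField.setoid 𝔽) q →
    (S : PG.PointSet 𝔽 n ℓ) (s : ℕ) → HasCardinality (PG.PointSet.points S) s →
    ¬ PG.HasCollinear 𝔽 n S (suc t) →
    s * q ^ (n + 1) ≤ ex (q ^ (n + 1)) (s * q ^ n) (C₄ ∷ θ₃ t ∷ [])
-- The case `t = 0` is excluded by `1 ≤ t`. The construction has `suc n` where the statement has
-- `n + 1`, hence the transport along `+-comm 1 n`.
theorem1p1 q (suc t) n _ _ _ 𝔽 finite S s size ¬collinear =
  subst (λ k → s * q ^ k ≤ ex (q ^ k) (s * q ^ n) (C₄ ∷ θ₃ (suc t) ∷ [])) (+-comm 1 n) (begin
    s * q ^ suc n   ≡⟨ *-comm s (q ^ suc n) ⟩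
    q ^ suc n * s   ≤⟨ edgeCount-incidenceGraph 𝔽 finite S size ⟩
    edgeCount G     ≤⟨ ex-upper (C₄ ∷ θ₃ (suc t) ∷ []) G (incidenceGraph-free 𝔽 finite S size ¬collinear) ⟩
    ex (q ^ suc n) (s * q ^ n) (C₄ ∷ θ₃ (suc t) ∷ []) ∎)
  where
  open ≤-Reasoning
  G = incidenceGraph 𝔽 finite S size
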